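{- The tensor product graph $P_n \wedge P_m$ is odd graceful for all integers $n$ and $m$.
   Context: All graphs are finite and simple. $P_n$ denotes the path graph on $n$ vertices. The tensor product $G_1 \wedge G_2$ of two graphs $G_1, G_2$ is the graph with vertex set $V(G_1) \times V(G_2)$ and edge set $E(G_1 \wedge G_2) = \{(u_1,v_1)(u_2,v_2) : u_1u_2 \in E(G_1) \text{ and } v_1v_2 \in E(G_2)\}$. (Thus $P_n \wedge P_m$ has $nm$ vertices and $2(n-1)(m-1)$ edges.) An odd graceful labeling of a graph $G$ with $q = |E(G)|$ edges is a one-to-one function $f : V(G) \to \{0,1,2,\ldots,2q-1\}$ such that, when each edge $uv$ is given the label $f^*(uv) = |f(u)-f(v)|$, the resulting edge labels are $\{1,3,\ldots,2q-1\}$. A graph is called odd graceful if it has an odd graceful labeling.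
   Formalization: "For all integers n and m" is taken as all n, m ≥ 2: if n or m is 1 the product has vertices but no edges, so q = 0, the label set {0,…,2q−1} is empty and no labeling exists. -}

module Defs where

open import Data.Fin using (Fin; toℕ; _<_; _<?_)
open import Data.Fin.Properties using (*↔×)
open import Data.List using (List; allFin; cartesianProduct; filter; length)
open import Data.Nat using (ℕ; suc; _+_; _*_; ∣_-_∣) renaming (_<_ to _<ℕ_)
open import Data.Nat.Properties using (_≟_; 1+n≢n)
open import Data.Product using (_×_; _,_; ∃-syntax)
open import Data.Product.Function.NonDependent.Propositional using (_×-↔_)
open import Data.Sum using (_⊎_; [_,_]; swap)
open import Function.Bundles using (_↔_; _⇔_; module Inverse)
open import Function.Construct.Composition using (_↔-∘_)
open import Function.Construct.Identity using (↔-id)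
open import Function.Definitions using (Injective)
open import Relation.Binary.Definitions using (Decidable; Irreflexive; Symmetric)
open import Relation.Binary.PropositionalEquality using (_≡_; refl)
open import Relation.Nullary.Decidable using (_×-dec_; _⊎-dec_)

record Graph : Set₁ where
  field
    V      : Set
    Adj    : V → V → Set
    adj?   : Decidable Adj
    sym    : Symmetric Adj
    irrefl : Irreflexive _≡_ Adj
    order  : ℕ
    enum   : Fin order ↔ V

  vertex : Fin order → V
  vertex = Inverse.to enum

  -- Each unordered edge is listed once, by its endpoints in increasing order
  -- of index.
  edges : List (Fin order × Fin order)
  edges = filter (λ (i , j) → (i <? j) ×-dec adj? (vertex i) (vertex j))
                 (cartesianProduct (allFin order) (allFin order))

  size : ℕ
  size = length edges

P : ℕ → Graph
P n = record
  { V      = Fin n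
  ; Adj    = λ i j → suc (toℕ i) ≡ toℕ j ⊎ suc (toℕ j) ≡ toℕ i
  ; adj?   = λ i j → (suc (toℕ i) ≟ toℕ j) ⊎-dec (suc (toℕ j) ≟ toℕ i)
  ; sym    = swap
  ; irrefl = λ { refl → [ 1+n≢n , 1+n≢n ] }
  ; order  = n
  ; enum   = ↔-id (Fin n)
  }

infixr 7 _∧_

_∧_ : Graph → Graph → Graph
G ∧ H = record
  { V      = G.V × H.V
  ; Adj    = λ (u₁ , v₁) (u₂ , v₂) → G.Adj u₁ u₂ × H.Adj v₁ v₂
  ; adj?   = λ (u₁ , v₁) (u₂ , v₂) → G.adj? u₁ u₂ ×-dec H.adj? v₁ v₂
  ; sym    = λ (a , b) → G.sym a , H.sym b
  ; irrefl = λ { refl (a , _) → G.irrefl refl a }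
  ; order  = G.order * H.order
  ; enum   = (G.enum ×-↔ H.enum) ↔-∘ *↔×
  }
  where
  module G = Graph G
  module H = Graph H

record OddGracefulLabeling (G : Graph) : Set where
  open Graph G
  field
    f         : V → Fin (2 * size)
    injective : Injective _≡_ _≡_ f

  edgeLabel : V → V → ℕ
  edgeLabel u v = ∣ toℕ (f u) - toℕ (f v) ∣

  -- The set of edge labels equals {1, 3, …, 2q − 1}, where q = size.
  field
    labels : ∀ k → (∃[ u ] ∃[ v ] (Adj u v × edgeLabel u v ≡ k))
                 ⇔ (∃[ i ] (i <ℕ size × k ≡ 2 * i + 1))

OddGraceful : Graph → Set
OddGraceful = OddGracefulLabeling

{-# OPTIONS --safe #-}

-- An edge of G with label a and an edge of H with label b span two edges of
-- G ∧ H.  If f and g are odd graceful labelings of G and H, which have p and q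
-- edges, then (u , v) ↦ 2q · f u + g v is injective because g v < 2q, and it
-- gives these two edges the labels 2qa − b and 2qa + b.  As a and b run over
-- the odd numbers below 2p and 2q, every odd number below 4pq occurs exactly
-- once, so odd gracefulness is preserved by tensor products.  Paths are odd
-- graceful: prepend a vertex labelled 0 and replace every old label x by
-- 2q − 1 − x, where q is the new number of edges.

module Submission where

open import Defs
open import Data.Fin
  using (Fin; zero; suc; toℕ; fromℕ; fromℕ<; cast; combine; remQuot; opposite; inject≤; _<_)
open import Data.Fin.Patterns using (0F; 1F)
open import Data.Fin.Properties
  using (toℕ<n; toℕ-injective; toℕ-fromℕ; toℕ-fromℕ<; toℕ-inject₁;
         toℕ-cast; toℕ-combine; toℕ-inject≤; combine-injective;
         combine-remQuot; remQuot-combine; opposite-prop; opposite-involutive; <-cmp; <-asym;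
         cantor-schröder-bernstein)
open import Data.List using (List; lookup; allFin; cartesianProduct)
open import Data.List.Membership.Propositional using (_∈_)
open import Data.List.Membership.Propositional.Properties
  using (∈-lookup; ∈-allFin; ∈-cartesianProduct⁺; ∈-filter⁺; ∈-filter⁻)
open import Data.List.Relation.Unary.All using () renaming (lookup to All-lookup)
open import Data.List.Relation.Unary.AllPairs using (_∷_)
open import Data.List.Relation.Unary.Any using (index)
open import Data.List.Relation.Unary.Any.Properties using (lookup-index)
open import Data.List.Relation.Unary.Unique.Propositional using (Unique)
open import Data.List.Relation.Unary.Unique.Propositional.Properties
  using (allFin⁺; cartesianProduct⁺; filter⁺)
open import Data.Nat using (ℕ; zero; suc; _+_; _*_; ∣_-_∣; _≤_; s≤s)
open import Data.Nat.Properties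
  using (*-assoc; *-cancelˡ-≡; *-cancelˡ-≤; *-monoʳ-≤; +-cancelʳ-≡; +-cancelˡ-≡; m∸n+n≡m; n≤1+n; 1+n≰n;
         ∣-∣-comm; ∣m-m+n∣≡n)
  renaming (suc-injective to ℕ-suc-injective)
open import Data.Nat.Tactic.RingSolver using (solve-∀)
open import Data.Product using (_×_; _,_; ∃-syntax; map₂; proj₁; proj₂)
open import Data.Sum using (_⊎_; inj₁; inj₂) renaming (map to map-⊎; swap to swap-⊎)
open import Function using (_∘_)
open import Function.Bundles using (mk⇔; Inverse)
open import Function.Definitions using (Injective)
open import Relation.Binary.Definitions using (tri<; tri≈; tri>)
open import Relation.Binary.PropositionalEquality
  using (_≡_; _≢_; refl; sym; trans; cong; cong₂; subst; subst₂; module ≡-Reasoning)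
open import Relation.Nullary using (contradiction)

-- Duplicate-free lists and reversal of `Fin n`.

lookup-injective : ∀ {A : Set} {xs : List A} → Unique xs → Injective _≡_ _≡_ (lookup xs)
lookup-injective (_ ∷ _)    {zero}  {zero}  _  = refl
lookup-injective (x∉xs ∷ _) {zero}  {suc j} eq = contradiction eq (All-lookup x∉xs (∈-lookup j))
lookup-injective (x∉xs ∷ _) {suc i} {zero}  eq = contradiction (sym eq) (All-lookup x∉xs (∈-lookup i))
lookup-injective (_ ∷ xs!)  {suc i} {suc j} eq = cong suc (lookup-injective xs! eq)

opposite-sum : ∀ {n} (i : Fin n) → toℕ (opposite i) + suc (toℕ i) ≡ n
opposite-sum {n} i = trans (cong (_+ suc (toℕ i)) (opposite-prop i)) (m∸n+n≡m (toℕ<n i))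

-- Labelings with numbered and oriented edges.

-- Edge t carries the label 2t + 1 and is oriented from its smaller to its
-- larger vertex label.
record OrientedLabeling (G : Graph) (q : ℕ) : Set where
  open Graph G using (V; Adj)
  field
    f           : V → Fin (2 * q)
    f-injective : Injective _≡_ _≡_ f
    src tgt     : Fin q → V
    adjacent    : ∀ t → Adj (src t) (tgt t)
    ascent      : ∀ t → toℕ (f (src t)) + (2 * toℕ t + 1) ≡ toℕ (f (tgt t))

  Arc : Fin q → V → V → Set
  Arc t u v = src t ≡ u × tgt t ≡ v

  field
    cover : ∀ {u v} → Adj u v → (∃[ t ] Arc t u v) ⊎ (∃[ t ] Arc t v u)

  label : V → V → ℕ
  label u v = ∣ toℕ (f u) - toℕ (f v) ∣

  label-arc : ∀ t → label (src t) (tgt t) ≡ 2 * toℕ t + 1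
  label-arc t = trans (cong (∣ toℕ (f (src t)) -_∣) (sym (ascent t)))
                      (∣m-m+n∣≡n (toℕ (f (src t))) (2 * toℕ t + 1))

  -- `edges` orders endpoints by index, which need not agree with the ascent of the labels, so
  -- comparing the two needs incidence without direction.
  Joins : Fin q → V → V → Set
  Joins t u v = Arc t u v ⊎ Arc t v u

  joined : ∀ {u v} → Adj u v → ∃[ t ] Joins t u v
  joined a with cover a
  ... | inj₁ (t , p) = t , inj₁ p
  ... | inj₂ (t , p) = t , inj₂ p

  label-joins : ∀ {t u v} → Joins t u v → label u v ≡ 2 * toℕ t + 1
  label-joins {t} (inj₁ (refl , refl)) = label-arc t
  label-joins {t} (inj₂ (refl , refl)) =
    trans (∣-∣-comm (toℕ (f (tgt t))) (toℕ (f (src t)))) (label-arc t)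

-- Counting the edges of a graph with an oriented labeling.

module _ {G : Graph} {q : ℕ} (L : OrientedLabeling G q) where
  open Graph G hiding (sym)
  open OrientedLabeling L

  private
    edges! : Unique edges
    edges! = filter⁺ _ (cartesianProduct⁺ (allFin⁺ order) (allFin⁺ order))

    ∈-edges : ∀ {i j} → i < j → Adj (vertex i) (vertex j) → (i , j) ∈ edges
    ∈-edges {i} {j} i<j a =
      ∈-filter⁺ _ (∈-cartesianProduct⁺ (∈-allFin i) (∈-allFin j)) (i<j , a)

    edges-sound : ∀ k → let (i , j) = lookup edges k in i < j × Adj (vertex i) (vertex j)
    edges-sound k = proj₂ (∈-filter⁻ _
      {xs = cartesianProduct (allFin order) (allFin order)} (∈-lookup k))

    vertex-surjective : ∀ v → ∃[ i ] vertex i ≡ v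
    vertex-surjective v = Inverse.from enum v , Inverse.strictlyInverseˡ enum v

    vertex-injective : Injective _≡_ _≡_ vertex
    vertex-injective {i} {j} eq =
      trans (sym (Inverse.strictlyInverseʳ enum i))
            (trans (cong (Inverse.from enum) eq) (Inverse.strictlyInverseʳ enum j))

    listed : ∀ t → ∃[ i ] ∃[ j ] ((i , j) ∈ edges × Joins t (vertex i) (vertex j))
    listed t with vertex-surjective (src t) | vertex-surjective (tgt t)
    ... | i , p | j , r with subst₂ Adj (sym p) (sym r) (adjacent t) | <-cmp i j
    ... | a | tri< i<j _ _ = i , j , ∈-edges i<j a , inj₁ (sym p , sym r)
    ... | a | tri≈ _ i≡j _ = contradiction a (irrefl (cong vertex i≡j))
    ... | a | tri> _ _ j<i = j , i , ∈-edges j<i (Graph.sym G a) , inj₂ (sym p , sym r)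

    position : Fin q → Fin size
    position t = index (proj₁ (proj₂ (proj₂ (listed t))))

    joins-position : ∀ t → let (i , j) = lookup edges (position t) in
                     Joins t (vertex i) (vertex j)
    joins-position t with listed t
    ... | i , j , ∈e , js = subst (λ (i , j) → Joins t (vertex i) (vertex j)) (lookup-index ∈e) js

    -- The endpoints determine the label 2t + 1, and that determines t.
    joins-unique : ∀ {t t′ u v} → Joins t u v → Joins t′ u v → t ≡ t′
    joins-unique p p′ = toℕ-injective (*-cancelˡ-≡ _ _ 2
      (+-cancelʳ-≡ 1 _ _ (trans (sym (label-joins p)) (label-joins p′))))

    position-injective : Injective _≡_ _≡_ position
    position-injective {t} {t′} eq = joins-unique (joins-position t)
      (subst (λ k → let (i , j) = lookup edges k in Joins t′ (vertex i) (vertex j))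
             (sym eq) (joins-position t′))

    -- If edge t were traversed in opposite directions, then k = j and l = i, against i < j and k <
    -- l.
    ends-unique : ∀ {t i j k l} → i < j → k < l →
                  Joins t (vertex i) (vertex j) → Joins t (vertex k) (vertex l) → (i , j) ≡ (k , l)
    ends-unique _ _ (inj₁ (a , b)) (inj₁ (c , d)) =
      cong₂ _,_ (vertex-injective (trans (sym a) c)) (vertex-injective (trans (sym b) d))
    ends-unique _ _ (inj₂ (a , b)) (inj₂ (c , d)) =
      cong₂ _,_ (vertex-injective (trans (sym b) d)) (vertex-injective (trans (sym a) c))
    ends-unique i<j k<l (inj₁ (a , b)) (inj₂ (c , d))
      with refl ← vertex-injective (trans (sym a) c) | refl ← vertex-injective (trans (sym b) d)
      = contradiction k<l (<-asym i<j)
    ends-unique i<j k<l (inj₂ (a , b)) (inj₁ (c , d))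
      with refl ← vertex-injective (trans (sym a) c) | refl ← vertex-injective (trans (sym b) d)
      = contradiction k<l (<-asym i<j)

    number : Fin size → Fin q
    number k = proj₁ (joined (proj₂ (edges-sound k)))

    number-injective : Injective _≡_ _≡_ number
    number-injective {k} {l} eq = lookup-injective edges!
      (ends-unique (proj₁ (edges-sound k)) (proj₁ (edges-sound l)) (joins k)
        (subst (λ t → Joins t _ _) (sym eq) (joins l)))
      where
      joins : ∀ k → Joins (number k) _ _
      joins k = proj₂ (joined (proj₂ (edges-sound k)))

  -- Edge indices and list positions inject into each other: labels separate the indices, and
  -- `edges` has no repetitions.
  size≡ : size ≡ q
  size≡ = cantor-schröder-bernstein number-injective position-injective

oriented⇒oddGraceful : ∀ {G q} → OrientedLabeling G q → OddGraceful G
oriented⇒oddGraceful {G} L₀ = record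
  { f         = f
  ; injective = f-injective
  ; labels    = λ k → mk⇔
      (λ { (u , v , a , refl) → let (t , p) = joined a in toℕ t , toℕ<n t , label-joins p })
      (λ { (i , i<q , refl) → let t = fromℕ< i<q in
           src t , tgt t , adjacent t ,
           trans (label-arc t) (cong (λ x → 2 * x + 1) (toℕ-fromℕ< i<q)) })
  }
  where
  -- The transport turns the codomain `Fin (2 * q)` into the required `Fin (2 * size)`.
  L = subst (OrientedLabeling G) (sym (size≡ L₀)) L₀
  open OrientedLabeling L

-- Tensor products.

module _ {G H : Graph} {p q : ℕ} (K : OrientedLabeling G p) (L : OrientedLabeling H q) where
  private
    module G = Graph G
    module H = Graph H
    module K = OrientedLabeling K
    module L = OrientedLabeling L
    module GH = Graph (G ∧ H)

    range : 2 * p * (2 * q) ≡ 2 * (p * (2 * q))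
    range = *-assoc 2 p (2 * q)

    f : GH.V → Fin (2 * (p * (2 * q)))
    f (u , v) = cast range (combine (K.f u) (L.f v))

    toℕ-f : ∀ u v → toℕ (f (u , v)) ≡ 2 * q * toℕ (K.f u) + toℕ (L.f v)
    toℕ-f u v = trans (toℕ-cast range _) (toℕ-combine (K.f u) (L.f v))

    f-injective : Injective _≡_ _≡_ f
    f-injective {u , v} {u′ , v′} eq =
      let (a , b) = combine-injective (K.f u) (L.f v) (K.f u′) (L.f v′)
                      (toℕ-injective (trans (sym (toℕ-cast range _))
                        (trans (cong toℕ eq) (toℕ-cast range _))))
      in cong₂ _,_ (K.f-injective a) (L.f-injective b)

    -- An edge a of G and an edge b of H span two product edges: 0F selects the difference label, 1F
    -- the sum label. With this order of digits, each a owns a block of 2q consecutive indices,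
    -- differences in its lower half and sums in its upper half.
    Index : Set
    Index = Fin p × Fin 2 × Fin q

    encode : Index → Fin (p * (2 * q))
    encode (a , ε , b) = combine a (combine ε b)

    decode : Fin (p * (2 * q)) → Index
    decode t = map₂ (remQuot q) (remQuot (2 * q) t)

    encode-decode : ∀ t → encode (decode t) ≡ t
    encode-decode t = let (a , c) = remQuot {p} (2 * q) t in
      trans (cong (combine a) (combine-remQuot {2} q c)) (combine-remQuot {p} (2 * q) t)

    decode-encode : ∀ x → decode (encode x) ≡ x
    decode-encode (a , ε , b) =
      trans (cong (map₂ (remQuot q)) (remQuot-combine a (combine ε b))) (cong (a ,_) (remQuot-combine ε b))

    toℕ-encode : ∀ a ε b → toℕ (encode (a , ε , b)) ≡ 2 * q * toℕ a + (q * toℕ ε + toℕ b)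
    toℕ-encode a ε b =
      trans (toℕ-combine a (combine ε b)) (cong (2 * q * toℕ a +_) (toℕ-combine ε b))

    -- The labels 2q(2a + 1) ± (2b + 1) are 2t + 1 with t = 2qa + q + b and
    -- t = 2qa + (q − 1 − b); the latter is why the index b is reversed for 0F.
    source target : Index → GH.V
    source (a , 0F , b) = K.src a , L.tgt (opposite b)
    source (a , 1F , b) = K.src a , L.src b
    target (a , 0F , b) = K.tgt a , L.src (opposite b)
    target (a , 1F , b) = K.tgt a , L.tgt b

    adjacent : ∀ x → GH.Adj (source x) (target x)
    adjacent (a , 0F , b) = K.adjacent a , H.sym (L.adjacent (opposite b))
    adjacent (a , 1F , b) = K.adjacent a , L.adjacent b

    sum-label : ∀ {x x′ y y′} q a b → x + (2 * a + 1) ≡ x′ → y + (2 * b + 1) ≡ y′ →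
                2 * q * x + y + (2 * (2 * q * a + (q * 1 + b)) + 1) ≡ 2 * q * x′ + y′
    sum-label {x} {y = y} q a b refl refl = identity q a b x y
      where
      identity : ∀ q a b x y → 2 * q * x + y + (2 * (2 * q * a + (q * 1 + b)) + 1)
                             ≡ 2 * q * (x + (2 * a + 1)) + (y + (2 * b + 1))
      identity = solve-∀

    -- Writing q as b′ + suc b avoids subtraction and leaves a ring identity. The H-labels y′ and y
    -- change sides because the H-edge is traversed downwards.
    difference-label : ∀ {x x′ y y′} q a b b′ → b′ + suc b ≡ q →
                       x + (2 * a + 1) ≡ x′ → y + (2 * b′ + 1) ≡ y′ →
                       2 * q * x + y′ + (2 * (2 * q * a + (q * 0 + b)) + 1) ≡ 2 * q * x′ + y
    difference-label {x} {y = y} _ a b b′ refl refl refl = identity a b b′ x y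
      where
      identity : ∀ a b b′ x y →
        2 * (b′ + suc b) * x + (y + (2 * b′ + 1)) + (2 * (2 * (b′ + suc b) * a + ((b′ + suc b) * 0 + b)) + 1)
        ≡ 2 * (b′ + suc b) * (x + (2 * a + 1)) + y
      identity = solve-∀

    ascent : ∀ x → toℕ (f (source x)) + (2 * toℕ (encode x) + 1) ≡ toℕ (f (target x))
    ascent (a , 0F , b)
      rewrite toℕ-f (K.src a) (L.tgt (opposite b))
            | toℕ-f (K.tgt a) (L.src (opposite b)) | toℕ-encode a 0F b
      = difference-label q (toℕ a) (toℕ b) (toℕ (opposite b))
          (opposite-sum b) (K.ascent a) (L.ascent (opposite b))
    ascent (a , 1F , b)
      rewrite toℕ-f (K.src a) (L.src b) | toℕ-f (K.tgt a) (L.tgt b) | toℕ-encode a 1F b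
      = sum-label q (toℕ a) (toℕ b) (K.ascent a) (L.ascent b)

    Arc : Index → GH.V → GH.V → Set
    Arc x u v = source x ≡ u × target x ≡ v

    -- The factor 2q lets the G-edge decide the direction of ascent. Arcs of G and H that agree in
    -- direction give a sum edge; arcs that disagree give a difference edge.
    cover : ∀ {u v} → GH.Adj u v → (∃[ x ] Arc x u v) ⊎ (∃[ x ] Arc x v u)
    cover (a , b) with K.cover a | L.cover b
    ... | inj₁ (s , refl , refl) | inj₁ (t , refl , refl) = inj₁ ((s , 1F , t) , refl , refl)
    ... | inj₂ (s , refl , refl) | inj₂ (t , refl , refl) = inj₂ ((s , 1F , t) , refl , refl)
    ... | inj₁ (s , refl , refl) | inj₂ (t , refl , refl) = inj₁ ((s , 0F , opposite t) ,
          cong (λ b → K.src s , L.tgt b) (opposite-involutive t) ,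
          cong (λ b → K.tgt s , L.src b) (opposite-involutive t))
    ... | inj₂ (s , refl , refl) | inj₁ (t , refl , refl) = inj₂ ((s , 0F , opposite t) ,
          cong (λ b → K.src s , L.tgt b) (opposite-involutive t) ,
          cong (λ b → K.tgt s , L.src b) (opposite-involutive t))

    encode-arc : ∀ {u v} → ∃[ x ] Arc x u v → ∃[ t ] (source (decode t) ≡ u × target (decode t) ≡ v)
    encode-arc (x , s , t) = encode x , trans (cong source (decode-encode x)) s
                                      , trans (cong target (decode-encode x)) t

  tensor : OrientedLabeling (G ∧ H) (p * (2 * q))
  tensor = record
    { f           = f
    ; f-injective = f-injective
    ; src         = source ∘ decode
    ; tgt         = target ∘ decode
    ; adjacent    = adjacent ∘ decode
    ; ascent      = λ t → subst (λ s → toℕ (f (source (decode t))) + (2 * toℕ s + 1)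
                                         ≡ toℕ (f (target (decode t))))
                                (encode-decode t) (ascent (decode t))
    ; cover       = map-⊎ encode-arc encode-arc ∘ cover
    }

-- Paths with at least two vertices.

module Path where

  -- With q = n + 1 edges this is the zigzag 0, 2q - 1, 2, 2q - 3, ....
  label : ∀ n → Fin (2 + n) → Fin (2 * (1 + n))
  label zero    i       = i
  label (suc n) zero    = zero
  label (suc n) (suc i) = opposite (inject≤ (label n i) (*-monoʳ-≤ 2 (n≤1+n (suc n))))

  label-zero : ∀ n → label n zero ≡ zero
  label-zero zero    = refl
  label-zero (suc n) = refl

  -- The reflection x ↦ 2q - 1 - x with q = n + 2, stated without subtraction.
  label-suc : ∀ n i → toℕ (label (suc n) (suc i)) + suc (toℕ (label n i)) ≡ 2 * (2 + n)
  label-suc n i =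
    trans (cong (λ x → toℕ (label (suc n) (suc i)) + suc x) (sym (toℕ-inject≤ (label n i) le)))
          (opposite-sum (inject≤ (label n i) le))
    where le = *-monoʳ-≤ 2 (n≤1+n (suc n))

  -- A reflected label 0 would come from the old label 2n + 3, but old labels are at most 2n + 1.
  -- Hence 0 is free for the new vertex.
  label-suc≢zero : ∀ n i → label (suc n) (suc i) ≢ zero
  label-suc≢zero n i eq = 1+n≰n {1 + n} (*-cancelˡ-≤ 2 (subst (_≤ 2 * (1 + n)) full (toℕ<n (label n i))))
    where
    full : suc (toℕ (label n i)) ≡ 2 * (2 + n)
    full = subst (λ x → toℕ x + suc (toℕ (label n i)) ≡ 2 * (2 + n)) eq (label-suc n i)

  label-injective : ∀ n → Injective _≡_ _≡_ (label n)
  label-injective zero    eq = eq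
  label-injective (suc n) {zero}  {zero}  _  = refl
  label-injective (suc n) {zero}  {suc j} eq = contradiction (sym eq) (label-suc≢zero n j)
  label-injective (suc n) {suc i} {zero}  eq = contradiction eq (label-suc≢zero n i)
  label-injective (suc n) {suc i} {suc j} eq = cong suc (label-injective n (toℕ-injective
    (ℕ-suc-injective (+-cancelˡ-≡ (toℕ (label (suc n) (suc i))) _ _
      (trans (label-suc n i) (trans (sym (label-suc n j))
        (cong (λ x → toℕ x + suc (toℕ (label n j))) (sym eq))))))))

  -- Edge i joins the vertices i and i + 1, upwards if i is even and downwards
  -- if i is odd.
  source target : ∀ n → Fin (1 + n) → Fin (2 + n)
  source n       zero    = zero
  source (suc n) (suc i) = suc (target n i)
  target n       zero    = suc zero
  target (suc n) (suc i) = suc (source n i)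

  adjacent : ∀ n i → Graph.Adj (P (2 + n)) (source n i) (target n i)
  adjacent n       zero    = inj₁ refl
  adjacent (suc n) (suc i) = swap-⊎ (map-⊎ (cong suc) (cong suc) (adjacent n i))

  -- The prepended edge joins the labels 0 and 2q - 1. Reflection preserves the old differences and
  -- reverses their direction, so labels fall along the path, hence `opposite i`.
  ascent : ∀ n i → toℕ (label n (source n i)) + (2 * toℕ (opposite i) + 1) ≡ toℕ (label n (target n i))
  ascent zero    zero    = refl
  ascent (suc n) zero    = +-cancelʳ-≡ 1 _ _ (begin
    2 * toℕ (fromℕ (suc n)) + 1 + 1    ≡⟨ cong (λ k → 2 * k + 1 + 1) (toℕ-fromℕ (suc n)) ⟩
    2 * (1 + n) + 1 + 1                ≡⟨ identity n ⟩
    2 * (2 + n)                        ≡⟨ label-suc n zero ⟨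
    x₁ + suc (toℕ (label n zero))      ≡⟨ cong (λ x → x₁ + suc (toℕ x)) (label-zero n) ⟩
    x₁ + 1                             ∎)
    where
    open ≡-Reasoning
    x₁ = toℕ (label (suc n) (suc zero))
    identity : ∀ n → 2 * (1 + n) + 1 + 1 ≡ 2 * (2 + n)
    identity = solve-∀
  -- Adding `suc a` to both sides lets `label-suc` clear the reflections: both sides become 2(n +
  -- 2).
  ascent (suc n) (suc i) rewrite toℕ-inject₁ (opposite i) = +-cancelʳ-≡ (suc a) _ _ (begin
    x + d + suc a                                              ≡⟨ identity x d a ⟩
    x + suc (a + d)                                            ≡⟨ cong (λ b → x + suc b) (ascent n i) ⟩
    x + suc (toℕ (label n (target n i)))                       ≡⟨ label-suc n (target n i) ⟩
    2 * (2 + n)                                                ≡⟨ label-suc n (source n i) ⟨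
    toℕ (label (suc n) (suc (source n i))) + suc a             ∎)
    where
    open ≡-Reasoning
    a = toℕ (label n (source n i))
    d = 2 * toℕ (opposite i) + 1
    x = toℕ (label (suc n) (suc (target n i)))
    identity : ∀ x d a → x + d + suc a ≡ x + suc (a + d)
    identity = solve-∀

  Arc : ∀ n → Fin (1 + n) → Fin (2 + n) → Fin (2 + n) → Set
  Arc n t i j = source n t ≡ i × target n t ≡ j

  cover : ∀ n {i j} → suc (toℕ i) ≡ toℕ j → (∃[ t ] Arc n t i j) ⊎ (∃[ t ] Arc n t j i)
  cover n       {zero}      {suc zero}    _  = inj₁ (zero , refl , refl)
  cover zero    {suc zero}  {suc zero}    ()
  cover (suc n) {suc i}     {suc j}       eq with cover n (ℕ-suc-injective eq)
  -- Prepending a vertex reverses every old edge, so the two alternatives are exchanged.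
  ... | inj₁ (t , refl , refl) = inj₂ (suc t , refl , refl)
  ... | inj₂ (t , refl , refl) = inj₁ (suc t , refl , refl)

  -- Edges are counted along the path with falling labels, whereas `OrientedLabeling` numbers them
  -- by rising labels.
  reindex : ∀ n {i j} → ∃[ t ] Arc n t i j → ∃[ t ] Arc n (opposite t) i j
  reindex n {i} {j} (t , p) = opposite t , subst (λ s → Arc n s i j) (sym (opposite-involutive t)) p

  oriented : ∀ n → OrientedLabeling (P (2 + n)) (1 + n)
  oriented n = record
    { f           = label n
    ; f-injective = label-injective n
    ; src         = source n ∘ opposite
    ; tgt         = target n ∘ opposite
    ; adjacent    = adjacent n ∘ opposite
    ; ascent      = λ t → subst (λ s → toℕ (label n (source n (opposite t))) + (2 * toℕ s + 1)
                                         ≡ toℕ (label n (target n (opposite t))))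
                                (opposite-involutive t) (ascent n (opposite t))
    ; cover       = λ
        { (inj₁ i→j) → map-⊎ (reindex n) (reindex n) (cover n i→j)
        ; (inj₂ j→i) → swap-⊎ (map-⊎ (reindex n) (reindex n) (cover n j→i))
        }
    }

theorem6 : (n m : ℕ) → 2 ≤ n → 2 ≤ m → OddGraceful (P n ∧ P m)
-- Matching on the bounds exposes both orders as `2 + _`, the form that `Path.oriented` produces.
theorem6 _ _ (s≤s (s≤s _)) (s≤s (s≤s _)) = oriented⇒oddGraceful (tensor (Path.oriented _) (Path.oriented _))
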